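{- Let $r$ and $d$ be two nonnegative integers and $P$ be a real polynomial of degree $d$. Let also $(T_n(X))_{n\ge 0}$ be the Carlitz-type $q$-polynomial sequence whose associated real sequence is $\left(\frac{P(k)}{[k+r]}\right)_{k\ge 0}$, and let $(t_n)_{n\ge 0}$ be the real sequence defined by $t_n:=T_n(0)$ for all $n\ge 0$. Then $(t_n)_n$ satisfies the symbolic formula $$q^r\left(qt+1\right)^n=t^n\qquad(\forall n>d),$$ that is, $$q^r\sum_{k=0}^{n}\binom{n}{k}q^k\,t_k=t_n\qquad(\forall n>d).$$
   Context: Let $q$ be a positive real parameter, $q\neq 1$, and put $[X]:=\frac{q^X-1}{q-1}$, where $X$ is an indeterminate or a number. A $q$-polynomial is a polynomial in $q^X$ (equivalently in $[X]$) with real coefficients. The Carlitz-type $q$-polynomial sequence associated to a real sequence $(a_k)_{k\ge 0}$ is the sequence $(T_n(X))_{n\ge 0}$ defined by $$T_n(X)=(q-1)^{ -n}\sum_{k=0}^{n}(-1)^{n-k}\binom{n}{k}a_k\,q^{kX}.$$ In symbolic formulas one expands by the binomial theorem and then replaces each power $t^k$ by $t_k$. The paper's convention is that $\frac{k}{[k]}=1$ for $k=0$.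
   Formalization: When r = 0 it is assumed that P(0) = 0, since otherwise P(0)/[0] is undefined (e.g. P = 1) and no value for it makes the formula true; the term at k = 0 is then (P(X)/X)(0), by the convention k/[k] = 1 at k = 0. -}

module Defs where

open import Algebra.Bundles using (CommutativeRing)
open import Data.Empty using (⊥-elim)
open import Data.Fin.Base using (Fin; toℕ; fromℕ)
open import Data.Nat.Base as ℕ using (ℕ; zero; suc)
open import Data.Nat.Combinatorics using (_C_)
import Data.Nat.Properties as ℕP
open import Data.Product.Base using (∃; ∃-syntax; _×_; _,_; proj₁; proj₂)
open import Data.Rational.Base as ℚ using (ℚ; 0ℚ; 1ℚ; ½)
import Data.Rational.Properties as ℚP
open import Data.Rational.Solver using (module +-*-Solver)
open import Data.Sum.Base using (_⊎_; inj₁; inj₂)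
open import Data.Vec.Functional using (Vector; tail)
open import Level using (0ℓ)
open import Relation.Binary.PropositionalEquality.Core as ≡ using (_≡_; _≢_)
open import Relation.Nullary.Decidable.Core using (yes; no)

private

  *-pos : ∀ {p q} → 0ℚ ℚ.< p → 0ℚ ℚ.< q → 0ℚ ℚ.< p ℚ.* q
  *-pos {p} {q} p>0 q>0 =
    ℚP.positive⁻¹ (p ℚ.* q)
      {{ℚP.pos*pos⇒pos p {{ℚ.positive p>0}} q {{ℚ.positive q>0}}}}

  +-pos : ∀ {p q} → 0ℚ ℚ.< p → 0ℚ ℚ.< q → 0ℚ ℚ.< p ℚ.+ q
  +-pos = ℚP.+-mono-<

  *-monoˡ : ∀ r {p q} → 0ℚ ℚ.≤ r → p ℚ.≤ q → r ℚ.* p ℚ.≤ r ℚ.* q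
  *-monoˡ r r≥0 = ℚP.*-monoˡ-≤-nonNeg r {{ℚ.nonNegative r≥0}}

  *-monoʳ : ∀ r {p q} → 0ℚ ℚ.≤ r → p ℚ.≤ q → p ℚ.* r ℚ.≤ q ℚ.* r
  *-monoʳ r r≥0 = ℚP.*-monoʳ-≤-nonNeg r {{ℚ.nonNegative r≥0}}

  recip : ∀ {p} → 0ℚ ℚ.< p → ∃[ r ] 0ℚ ℚ.< r × p ℚ.* r ≡ 1ℚ
  recip {p} p>0 =
    (ℚ.1/ p) {{p≢0}} ,
    ℚP.positive⁻¹ ((ℚ.1/ p) {{p≢0}}) {{ℚP.1/pos⇒pos p {{p⁺}}}} ,
    ℚP.*-inverseʳ p {{p≢0}}
    where
    p⁺  = ℚ.positive p>0
    p≢0 = ℚP.pos⇒nonZero p {{p⁺}}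

  halve : ∀ {ε} → 0ℚ ℚ.< ε → ∃[ δ ] 0ℚ ℚ.< δ × δ ℚ.+ δ ≡ ε
  halve {ε} ε>0 =
    ½ ℚ.* ε , *-pos (ℚP.positive⁻¹ ½) ε>0 ,
    ≡.trans (≡.sym (ℚP.*-distribʳ-+ ε ½ ½)) (ℚP.*-identityˡ ε)

  scale : ∀ {M ε} → 0ℚ ℚ.< M → 0ℚ ℚ.< ε → ∃[ δ ] 0ℚ ℚ.< δ × M ℚ.* δ ≡ ε
  scale {M} {ε} M>0 ε>0 with recip M>0
  ... | K , K>0 , MK≡1 =
    K ℚ.* ε , *-pos K>0 ε>0 ,
    ≡.trans (≡.sym (ℚP.*-assoc M K ε))
      (≡.trans (≡.cong (ℚ._* ε) MK≡1) (ℚP.*-identityˡ ε))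

  dist-sym : ∀ p q → ℚ.∣ p ℚ.- q ∣ ≡ ℚ.∣ q ℚ.- p ∣
  dist-sym p q = ≡.trans (≡.cong ℚ.∣_∣ (lem p q)) (ℚP.∣-p∣≡∣p∣ (q ℚ.- p))
    where
    open +-*-Solver
    lem : ∀ p q → p ℚ.- q ≡ ℚ.- (q ℚ.- p)
    lem = solve 2 (λ p q → p :- q := :- (q :- p)) ≡.refl

  dist-self : ∀ p → ℚ.∣ p ℚ.- p ∣ ≡ 0ℚ
  dist-self p = ≡.cong ℚ.∣_∣ (ℚP.+-inverseʳ p)

  tri : ∀ {a b c δ η} → ℚ.∣ a ℚ.- b ∣ ℚ.≤ δ → ℚ.∣ b ℚ.- c ∣ ℚ.≤ η →
        ℚ.∣ a ℚ.- c ∣ ℚ.≤ δ ℚ.+ η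
  tri {a} {b} {c} p q =
    ℚP.≤-trans
      (ℚP.≤-trans (ℚP.≤-reflexive (≡.cong ℚ.∣_∣ (lem a b c)))
                  (ℚP.∣p+q∣≤∣p∣+∣q∣ (a ℚ.- b) (b ℚ.- c)))
      (ℚP.+-mono-≤ p q)
    where
    open +-*-Solver
    lem : ∀ a b c → a ℚ.- c ≡ (a ℚ.- b) ℚ.+ (b ℚ.- c)
    lem = solve 3 (λ a b c → a :- c := (a :- b) :+ (b :- c)) ≡.refl

  p≤∣p∣ : ∀ p → p ℚ.≤ ℚ.∣ p ∣
  p≤∣p∣ p with ℚP.≤-total 0ℚ p
  ... | inj₁ 0≤p = ℚP.≤-reflexive (≡.sym (ℚP.0≤p⇒∣p∣≡p 0≤p))
  ... | inj₂ p≤0 = ℚP.≤-trans p≤0 (ℚP.0≤∣p∣ p)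

  dist⇒≤ : ∀ {p q δ} → ℚ.∣ p ℚ.- q ∣ ℚ.≤ δ → p ℚ.≤ q ℚ.+ δ
  dist⇒≤ {p} {q} h =
    ℚP.≤-trans (ℚP.≤-reflexive (lem p q))
      (ℚP.+-monoʳ-≤ q (ℚP.≤-trans (p≤∣p∣ (p ℚ.- q)) h))
    where
    open +-*-Solver
    lem : ∀ p q → p ≡ q ℚ.+ (p ℚ.- q)
    lem = solve 2 (λ p q → p := q :+ (p :- q)) ≡.refl

  +-close : ∀ {a a′ b b′ δ η} →
            ℚ.∣ a ℚ.- a′ ∣ ℚ.≤ δ → ℚ.∣ b ℚ.- b′ ∣ ℚ.≤ η →
            ℚ.∣ (a ℚ.+ b) ℚ.- (a′ ℚ.+ b′) ∣ ℚ.≤ δ ℚ.+ η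
  +-close {a} {a′} {b} {b′} p q =
    ℚP.≤-trans
      (ℚP.≤-trans (ℚP.≤-reflexive (≡.cong ℚ.∣_∣ (lem a a′ b b′)))
                  (ℚP.∣p+q∣≤∣p∣+∣q∣ (a ℚ.- a′) (b ℚ.- b′)))
      (ℚP.+-mono-≤ p q)
    where
    open +-*-Solver
    lem : ∀ a a′ b b′ →
          (a ℚ.+ b) ℚ.- (a′ ℚ.+ b′) ≡ (a ℚ.- a′) ℚ.+ (b ℚ.- b′)
    lem = solve 4 (λ a a′ b b′ →
            (a :+ b) :- (a′ :+ b′) := (a :- a′) :+ (b :- b′)) ≡.refl

  neg-close : ∀ {a a′ δ} → ℚ.∣ a ℚ.- a′ ∣ ℚ.≤ δ →
              ℚ.∣ (ℚ.- a) ℚ.- (ℚ.- a′) ∣ ℚ.≤ δ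
  neg-close {a} {a′} p =
    ℚP.≤-trans
      (ℚP.≤-reflexive (≡.trans (≡.cong ℚ.∣_∣ (lem a a′)) (dist-sym a′ a))) p
    where
    open +-*-Solver
    lem : ∀ a a′ → (ℚ.- a) ℚ.- (ℚ.- a′) ≡ a′ ℚ.- a
    lem = solve 2 (λ a a′ → (:- a) :- (:- a′) := a′ :- a) ≡.refl

  ∣*∣≤ : ∀ a b {M δ} → ℚ.∣ a ∣ ℚ.≤ M → ℚ.∣ b ∣ ℚ.≤ δ →
         ℚ.∣ a ℚ.* b ∣ ℚ.≤ M ℚ.* δ
  ∣*∣≤ a b {M} {δ} p q =
    ℚP.≤-trans (ℚP.≤-reflexive (ℚP.∣p*q∣≡∣p∣*∣q∣ a b))
      (ℚP.≤-trans (*-monoʳ ℚ.∣ b ∣ (ℚP.0≤∣p∣ b) p)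
                  (*-monoˡ M (ℚP.≤-trans (ℚP.0≤∣p∣ a) p) q))

  *-close : ∀ {a a′ b b′ M δ} → ℚ.∣ a ∣ ℚ.≤ M → ℚ.∣ b′ ∣ ℚ.≤ M →
            ℚ.∣ a ℚ.- a′ ∣ ℚ.≤ δ → ℚ.∣ b ℚ.- b′ ∣ ℚ.≤ δ →
            ℚ.∣ a ℚ.* b ℚ.- a′ ℚ.* b′ ∣ ℚ.≤ M ℚ.* δ ℚ.+ M ℚ.* δ
  *-close {a} {a′} {b} {b′} {M} {δ} a≤M b′≤M aa′ bb′ =
    ℚP.≤-trans
      (ℚP.≤-trans (ℚP.≤-reflexive (≡.cong ℚ.∣_∣ (lem a a′ b b′)))
                  (ℚP.∣p+q∣≤∣p∣+∣q∣ (a ℚ.* (b ℚ.- b′)) (b′ ℚ.* (a ℚ.- a′))))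
      (ℚP.+-mono-≤ (∣*∣≤ a (b ℚ.- b′) a≤M bb′) (∣*∣≤ b′ (a ℚ.- a′) b′≤M aa′))
    where
    open +-*-Solver
    lem : ∀ a a′ b b′ → a ℚ.* b ℚ.- a′ ℚ.* b′ ≡
                        a ℚ.* (b ℚ.- b′) ℚ.+ b′ ℚ.* (a ℚ.- a′)
    lem = solve 4 (λ a a′ b b′ → a :* b :- a′ :* b′ :=
            a :* (b :- b′) :+ b′ :* (a :- a′)) ≡.refl

  -- Total inverse, with the junk value 0 at 0.
  inv : ℚ → ℚ
  inv p with p ℚP.≟ 0ℚ
  ... | yes _   = 0ℚ
  ... | no  p≢0 = (ℚ.1/ p) {{ℚ.≢-nonZero p≢0}}

  *-inv : ∀ {p} → p ≢ 0ℚ → p ℚ.* inv p ≡ 1ℚ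
  *-inv {p} p≢0 with p ℚP.≟ 0ℚ
  ... | yes p≡0 = ⊥-elim (p≢0 p≡0)
  ... | no  p≢0 = ℚP.*-inverseʳ p {{ℚ.≢-nonZero p≢0}}

  ≤∣∣⇒≢0 : ∀ {p δ} → 0ℚ ℚ.< δ → δ ℚ.≤ ℚ.∣ p ∣ → p ≢ 0ℚ
  ≤∣∣⇒≢0 δ>0 h ≡.refl = ℚP.<-irrefl ≡.refl (ℚP.<-≤-trans δ>0 h)

  ∣inv∣≤ : ∀ {p δ K} → 0ℚ ℚ.< δ → δ ℚ.≤ ℚ.∣ p ∣ → δ ℚ.* K ≡ 1ℚ →
           ℚ.∣ inv p ∣ ℚ.≤ K
  ∣inv∣≤ {p} {δ} {K} δ>0 h δK≡1 =
    ℚP.*-cancelˡ-≤-pos δ {{ℚ.positive δ>0}} (begin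
      δ ℚ.* ℚ.∣ inv p ∣          ≤⟨ *-monoʳ ℚ.∣ inv p ∣ (ℚP.0≤∣p∣ (inv p)) h ⟩
      ℚ.∣ p ∣ ℚ.* ℚ.∣ inv p ∣    ≡⟨ ℚP.∣p*q∣≡∣p∣*∣q∣ p (inv p) ⟨
      ℚ.∣ p ℚ.* inv p ∣          ≡⟨ ≡.cong ℚ.∣_∣ (*-inv (≤∣∣⇒≢0 {p} δ>0 h)) ⟩
      1ℚ                         ≡⟨ δK≡1 ⟨
      δ ℚ.* K                    ∎)
    where open ℚP.≤-Reasoning

  inv-close : ∀ {a b δ K η} → 0ℚ ℚ.< δ → δ ℚ.* K ≡ 1ℚ →
              δ ℚ.≤ ℚ.∣ a ∣ → δ ℚ.≤ ℚ.∣ b ∣ → ℚ.∣ a ℚ.- b ∣ ℚ.≤ η →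
              ℚ.∣ inv a ℚ.- inv b ∣ ℚ.≤ K ℚ.* (K ℚ.* η)
  inv-close {a} {b} {δ} {K} {η} δ>0 δK≡1 ha hb ab = begin
    ℚ.∣ inv a ℚ.- inv b ∣                 ≡⟨ ≡.cong ℚ.∣_∣ eq ⟩
    ℚ.∣ inv a ℚ.* (inv b ℚ.* (b ℚ.- a)) ∣ ≤⟨ ∣*∣≤ (inv a) _ (∣inv∣≤ {a} δ>0 ha δK≡1)
                                               (∣*∣≤ (inv b) _ (∣inv∣≤ {b} δ>0 hb δK≡1)
                                                 (ℚP.≤-trans (ℚP.≤-reflexive (dist-sym b a)) ab)) ⟩
    K ℚ.* (K ℚ.* η)                       ∎
    where
    open ℚP.≤-Reasoning
    open +-*-Solver
    lem : ∀ a b i j → i ℚ.* (j ℚ.* (b ℚ.- a)) ≡ i ℚ.* (b ℚ.* j) ℚ.- j ℚ.* (a ℚ.* i)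
    lem = solve 4 (λ a b i j → i :* (j :* (b :- a)) :=
            i :* (b :* j) :- j :* (a :* i)) ≡.refl
    eq : inv a ℚ.- inv b ≡ inv a ℚ.* (inv b ℚ.* (b ℚ.- a))
    eq = ≡.sym (≡.trans (lem a b (inv a) (inv b))
           (≡.cong₂ ℚ._-_
             (≡.trans (≡.cong (inv a ℚ.*_) (*-inv (≤∣∣⇒≢0 {b} δ>0 hb))) (ℚP.*-identityʳ (inv a)))
             (≡.trans (≡.cong (inv b ℚ.*_) (*-inv (≤∣∣⇒≢0 {a} δ>0 ha))) (ℚP.*-identityʳ (inv b)))))

Eventually : (ℕ → Set) → Set
Eventually P = ∃[ N ] ∀ n → N ℕ.≤ n → P n

private

  both : ∀ {P Q R : ℕ → Set} → (∀ {n} → P n → Q n → R n) →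
         Eventually P → Eventually Q → Eventually R
  both f (M , p) (N , q) =
    M ℕ.⊔ N , λ n h → f (p n (ℕP.m⊔n≤o⇒m≤o M N h)) (q n (ℕP.m⊔n≤o⇒n≤o M N h))

  always : ∀ {P : ℕ → Set} → (∀ n → P n) → Eventually P
  always p = 0 , λ n _ → p n

  weaken : ∀ {P Q : ℕ → Set} → (∀ {n} → P n → Q n) → Eventually P → Eventually Q
  weaken f (N , p) = N , λ n h → f (p n h)

record ℝ : Set where
  no-eta-equality
  field
    seq    : ℕ → ℚ
    cauchy : ∀ {ε} → 0ℚ ℚ.< ε →
             ∃[ N ] ∀ m n → N ℕ.≤ m → N ℕ.≤ n → ℚ.∣ seq m ℚ.- seq n ∣ ℚ.≤ ε
open ℝ public

infix 4 _≃_ _<_ _#_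

record _≃_ (x y : ℝ) : Set where
  constructor mk≃
  field
    close : ∀ {ε} → 0ℚ ℚ.< ε → Eventually λ n → ℚ.∣ seq x n ℚ.- seq y n ∣ ℚ.≤ ε
open _≃_ public

record _<_ (x y : ℝ) : Set where
  constructor mk<
  field
    gap     : ℚ
    gap>0   : 0ℚ ℚ.< gap
    bounded : Eventually λ n → seq x n ℚ.+ gap ℚ.≤ seq y n
open _<_ public

-- Apartness, the constructive form of x ≠ y: multiplicative inverses exist
-- for reals apart from 0.  With excluded middle, x # y iff not x ≃ y.
_#_ : ℝ → ℝ → Set
x # y = x < y ⊎ y < x

private

  ≡⇒≃ : ∀ {x y} → (∀ n → seq x n ≡ seq y n) → x ≃ y
  ≡⇒≃ {x} {y} eq = mk≃ λ {ε} ε>0 → always λ n →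
    ≡.subst (λ z → ℚ.∣ seq x n ℚ.- z ∣ ℚ.≤ ε) (eq n)
      (ℚP.≤-trans (ℚP.≤-reflexive (dist-self (seq x n))) (ℚP.<⇒≤ ε>0))

≃-refl : ∀ {x} → x ≃ x
≃-refl = ≡⇒≃ λ _ → ≡.refl

≃-sym : ∀ {x y} → x ≃ y → y ≃ x
≃-sym {x} {y} x≃y = mk≃ λ ε>0 →
  weaken (λ {n} → ℚP.≤-trans (ℚP.≤-reflexive (dist-sym (seq y n) (seq x n))))
    (close x≃y ε>0)

≃-trans : ∀ {x y z} → x ≃ y → y ≃ z → x ≃ z
≃-trans {x} {y} {z} x≃y y≃z .close ε>0 with halve ε>0
... | δ , δ>0 , ≡.refl =
  both (λ {n} → tri {seq x n} {seq y n} {seq z n} {δ} {δ}) (close x≃y δ>0) (close y≃z δ>0)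

fromℚ : ℚ → ℝ
fromℚ p .seq _      = p
fromℚ p .cauchy ε>0 =
  0 , λ _ _ _ _ → ℚP.≤-trans (ℚP.≤-reflexive (dist-self p)) (ℚP.<⇒≤ ε>0)

0ℝ 1ℝ : ℝ
0ℝ = fromℚ 0ℚ
1ℝ = fromℚ 1ℚ

infixl 6 _+ℝ_
infixl 7 _*ℝ_
infix  8 -ℝ_

_+ℝ_ : ℝ → ℝ → ℝ
(x +ℝ y) .seq n = seq x n ℚ.+ seq y n
(x +ℝ y) .cauchy ε>0 with halve ε>0
... | δ , δ>0 , ≡.refl with cauchy x δ>0 | cauchy y δ>0
... | M , p | N , q = M ℕ.⊔ N , λ m n hm hn →
  +-close {seq x m} {seq x n} {seq y m} {seq y n} {δ} {δ}
    (p m n (ℕP.m⊔n≤o⇒m≤o M N hm) (ℕP.m⊔n≤o⇒m≤o M N hn))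
    (q m n (ℕP.m⊔n≤o⇒n≤o M N hm) (ℕP.m⊔n≤o⇒n≤o M N hn))

-ℝ_ : ℝ → ℝ
(-ℝ x) .seq n = ℚ.- seq x n
(-ℝ x) .cauchy ε>0 with cauchy x ε>0
... | N , p = N , λ m n hm hn → neg-close {seq x m} {seq x n} (p m n hm hn)

private

  eventuallyBounded : ∀ x → ∃[ M ] 0ℚ ℚ.< M × Eventually λ n → ℚ.∣ seq x n ∣ ℚ.≤ M
  eventuallyBounded x with cauchy x (ℚP.positive⁻¹ 1ℚ)
  ... | N , p =
    1ℚ ℚ.+ ℚ.∣ seq x N ∣ ,
    ℚP.+-mono-<-≤ (ℚP.positive⁻¹ 1ℚ) (ℚP.0≤∣p∣ (seq x N)) ,
    N , λ n h → bound n (p n N h ℕP.≤-refl)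
    where
    open +-*-Solver
    lem : ∀ a b → a ≡ (a ℚ.- b) ℚ.+ b
    lem = solve 2 (λ a b → a := (a :- b) :+ b) ≡.refl
    bound : ∀ n → ℚ.∣ seq x n ℚ.- seq x N ∣ ℚ.≤ 1ℚ →
            ℚ.∣ seq x n ∣ ℚ.≤ 1ℚ ℚ.+ ℚ.∣ seq x N ∣
    bound n h = ℚP.≤-trans
      (ℚP.≤-trans (ℚP.≤-reflexive (≡.cong ℚ.∣_∣ (lem (seq x n) (seq x N))))
                  (ℚP.∣p+q∣≤∣p∣+∣q∣ (seq x n ℚ.- seq x N) (seq x N)))
      (ℚP.+-monoˡ-≤ ℚ.∣ seq x N ∣ h)

  p≤p+q : ∀ p q → 0ℚ ℚ.< q → p ℚ.≤ p ℚ.+ q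
  p≤p+q p q q>0 =
    ≡.subst (ℚ._≤ p ℚ.+ q) (ℚP.+-identityʳ p) (ℚP.+-monoʳ-≤ p {0ℚ} {q} (ℚP.<⇒≤ q>0))

  q≤p+q : ∀ p q → 0ℚ ℚ.< p → q ℚ.≤ p ℚ.+ q
  q≤p+q p q p>0 =
    ≡.subst (ℚ._≤ p ℚ.+ q) (ℚP.+-identityˡ q) (ℚP.+-monoˡ-≤ q {0ℚ} {p} (ℚP.<⇒≤ p>0))

  Bound : ℝ → ℚ → Set
  Bound x M = Eventually λ n → ℚ.∣ seq x n ∣ ℚ.≤ M

  weakenBound : ∀ x {A B} → A ℚ.≤ B → Bound x A → Bound x B
  weakenBound x A≤B (N , p) = N , λ n h → ℚP.≤-trans (p n h) A≤B

  commonBound : ∀ x y → ∃[ M ] 0ℚ ℚ.< M × Bound x M × Bound y M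
  commonBound x y = join (eventuallyBounded x) (eventuallyBounded y)
    where
    join : ∃[ A ] 0ℚ ℚ.< A × Bound x A → ∃[ B ] 0ℚ ℚ.< B × Bound y B →
           ∃[ M ] 0ℚ ℚ.< M × Bound x M × Bound y M
    join (A , A>0 , a) (B , B>0 , b) =
      A ℚ.+ B , +-pos {A} {B} A>0 B>0 ,
      weakenBound x (p≤p+q A B B>0) a , weakenBound y (q≤p+q A B A>0) b

  productTolerance : ∀ {M ε} → 0ℚ ℚ.< M → 0ℚ ℚ.< ε →
                     ∃[ δ ] 0ℚ ℚ.< δ × M ℚ.* δ ℚ.+ M ℚ.* δ ≡ ε
  productTolerance {M} {ε} M>0 ε>0 = join (halve ε>0)
    where
    join : ∃[ η ] 0ℚ ℚ.< η × η ℚ.+ η ≡ ε → ∃[ δ ] 0ℚ ℚ.< δ × M ℚ.* δ ℚ.+ M ℚ.* δ ≡ ε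
    join (η , η>0 , η+η≡ε) = join′ (scale M>0 η>0)
      where
      join′ : ∃[ δ ] 0ℚ ℚ.< δ × M ℚ.* δ ≡ η → ∃[ δ ] 0ℚ ℚ.< δ × M ℚ.* δ ℚ.+ M ℚ.* δ ≡ ε
      join′ (δ , δ>0 , Mδ≡η) = δ , δ>0 , ≡.trans (≡.cong (λ z → z ℚ.+ z) Mδ≡η) η+η≡ε

  CauchyAt : (ℕ → ℚ) → ℚ → Set
  CauchyAt s ε = ∃[ N ] ∀ m n → N ℕ.≤ m → N ℕ.≤ n → ℚ.∣ s m ℚ.- s n ∣ ℚ.≤ ε

  *-cauchy : ∀ x y M δ ε → M ℚ.* δ ℚ.+ M ℚ.* δ ≡ ε → Bound x M → Bound y M →
             CauchyAt (seq x) δ → CauchyAt (seq y) δ →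
             CauchyAt (λ n → seq x n ℚ.* seq y n) ε
  *-cauchy x y M δ ε eq (L₁ , b₁) (L₂ , b₂) (N₁ , p) (N₂ , q) =
    (L₁ ℕ.⊔ L₂) ℕ.⊔ (N₁ ℕ.⊔ N₂) , λ m n hm hn →
    let hLm = ℕP.m⊔n≤o⇒m≤o (L₁ ℕ.⊔ L₂) (N₁ ℕ.⊔ N₂) hm
        hLn = ℕP.m⊔n≤o⇒m≤o (L₁ ℕ.⊔ L₂) (N₁ ℕ.⊔ N₂) hn
        hNm = ℕP.m⊔n≤o⇒n≤o (L₁ ℕ.⊔ L₂) (N₁ ℕ.⊔ N₂) hm
        hNn = ℕP.m⊔n≤o⇒n≤o (L₁ ℕ.⊔ L₂) (N₁ ℕ.⊔ N₂) hn
    in ≡.subst (ℚ.∣ seq x m ℚ.* seq y m ℚ.- seq x n ℚ.* seq y n ∣ ℚ.≤_) eq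
         (*-close {seq x m} {seq x n} {seq y m} {seq y n} {M} {δ}
           (b₁ m (ℕP.m⊔n≤o⇒m≤o L₁ L₂ hLm)) (b₂ n (ℕP.m⊔n≤o⇒n≤o L₁ L₂ hLn))
           (p m n (ℕP.m⊔n≤o⇒m≤o N₁ N₂ hNm) (ℕP.m⊔n≤o⇒m≤o N₁ N₂ hNn))
           (q m n (ℕP.m⊔n≤o⇒n≤o N₁ N₂ hNm) (ℕP.m⊔n≤o⇒n≤o N₁ N₂ hNn)))

_*ℝ_ : ℝ → ℝ → ℝ
(x *ℝ y) .seq n = seq x n ℚ.* seq y n
(x *ℝ y) .cauchy {ε} ε>0 =
  let M , M>0 , b , c = commonBound x y
      δ , δ>0 , eq    = productTolerance {M} {ε} M>0 ε>0
  in *-cauchy x y M δ ε eq b c (cauchy x δ>0) (cauchy y δ>0)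

+ℝ-cong : ∀ {x x′ y y′} → x ≃ x′ → y ≃ y′ → x +ℝ y ≃ x′ +ℝ y′
+ℝ-cong {x} {x′} {y} {y′} p q .close ε>0 with halve ε>0
... | δ , δ>0 , ≡.refl =
  both (λ {n} → +-close {seq x n} {seq x′ n} {seq y n} {seq y′ n} {δ} {δ})
    (close p δ>0) (close q δ>0)

-ℝ-cong : ∀ {x x′} → x ≃ x′ → -ℝ x ≃ -ℝ x′
-ℝ-cong {x} {x′} p .close ε>0 =
  weaken (λ {n} → neg-close {seq x n} {seq x′ n}) (close p ε>0)

*ℝ-cong : ∀ {x x′ y y′} → x ≃ x′ → y ≃ y′ → x *ℝ y ≃ x′ *ℝ y′
*ℝ-cong {x} {x′} {y} {y′} p q .close {ε} ε>0 =
  let M , M>0 , b , c = commonBound x y′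
      δ , δ>0 , eq    = productTolerance {M} {ε} M>0 ε>0
  in both (λ {n} (u , v) (s , t) →
            ≡.subst (ℚ.∣ seq x n ℚ.* seq y n ℚ.- seq x′ n ℚ.* seq y′ n ∣ ℚ.≤_) eq
              (*-close {seq x n} {seq x′ n} {seq y n} {seq y′ n} {M} {δ} u v s t))
       (both _,_ b c) (both _,_ (close p δ>0) (close q δ>0))

ℝ-commutativeRing : CommutativeRing 0ℓ 0ℓ
ℝ-commutativeRing = record
  { Carrier = ℝ ; _≈_ = _≃_ ; _+_ = _+ℝ_ ; _*_ = _*ℝ_ ; -_ = -ℝ_ ; 0# = 0ℝ ; 1# = 1ℝ
  ; isCommutativeRing = record
    { isRing = record
      { +-isAbelianGroup = record
        { isGroup = record
          { isMonoid = record
            { isSemigroup = record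
              { isMagma = record
                { isEquivalence = record { refl = ≃-refl ; sym = ≃-sym ; trans = ≃-trans }
                ; ∙-cong = +ℝ-cong
                }
              ; assoc = λ x y z → ≡⇒≃ λ n → ℚP.+-assoc (seq x n) (seq y n) (seq z n)
              }
            ; identity = (λ x → ≡⇒≃ λ n → ℚP.+-identityˡ (seq x n))
                       , (λ x → ≡⇒≃ λ n → ℚP.+-identityʳ (seq x n))
            }
          ; inverse = (λ x → ≡⇒≃ λ n → ℚP.+-inverseˡ (seq x n))
                    , (λ x → ≡⇒≃ λ n → ℚP.+-inverseʳ (seq x n))
          ; ⁻¹-cong = -ℝ-cong
          }
        ; comm = λ x y → ≡⇒≃ λ n → ℚP.+-comm (seq x n) (seq y n)
        }
      ; *-cong = *ℝ-cong
      ; *-assoc = λ x y z → ≡⇒≃ λ n → ℚP.*-assoc (seq x n) (seq y n) (seq z n)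
      ; *-identity = (λ x → ≡⇒≃ λ n → ℚP.*-identityˡ (seq x n))
                   , (λ x → ≡⇒≃ λ n → ℚP.*-identityʳ (seq x n))
      ; distrib = (λ x y z → ≡⇒≃ λ n → ℚP.*-distribˡ-+ (seq x n) (seq y n) (seq z n))
                , (λ x y z → ≡⇒≃ λ n → ℚP.*-distribʳ-+ (seq x n) (seq y n) (seq z n))
      }
    ; *-comm = λ x y → ≡⇒≃ λ n → ℚP.*-comm (seq x n) (seq y n)
    }
  }

open CommutativeRing ℝ-commutativeRing public
  using (_+_; _*_; -_; _-_)
open import Algebra.Properties.Semiring.Exp (CommutativeRing.semiring ℝ-commutativeRing) public
  using (_^_)
open import Algebra.Properties.Semiring.Mult (CommutativeRing.semiring ℝ-commutativeRing) public
  using () renaming (_×_ to infixr 8 _·_)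
open import Algebra.Properties.Semiring.Sum (CommutativeRing.semiring ℝ-commutativeRing) public
  using (sum; sum⁺-syntax)

private

  awayFromZero : ∀ {x} → x # 0ℝ →
    ∃[ δ ] 0ℚ ℚ.< δ × Eventually λ n → δ ℚ.≤ ℚ.∣ seq x n ∣
  awayFromZero {x} (inj₁ (mk< δ δ>0 b)) = δ , δ>0 , weaken (λ {n} → lem (seq x n)) b
    where
    open +-*-Solver
    eq : ∀ δ p → δ ≡ (p ℚ.+ δ) ℚ.+ (ℚ.- p)
    eq = solve 2 (λ δ p → δ := (p :+ δ) :+ (:- p)) ≡.refl
    lem : ∀ p → p ℚ.+ δ ℚ.≤ 0ℚ → δ ℚ.≤ ℚ.∣ p ∣
    lem p h = begin
      δ                       ≡⟨ eq δ p ⟩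
      (p ℚ.+ δ) ℚ.+ (ℚ.- p)   ≤⟨ ℚP.+-monoˡ-≤ (ℚ.- p) h ⟩
      0ℚ ℚ.+ (ℚ.- p)          ≡⟨ ℚP.+-identityˡ (ℚ.- p) ⟩
      ℚ.- p                   ≤⟨ p≤∣p∣ (ℚ.- p) ⟩
      ℚ.∣ ℚ.- p ∣             ≡⟨ ℚP.∣-p∣≡∣p∣ p ⟩
      ℚ.∣ p ∣                 ∎
      where open ℚP.≤-Reasoning
  awayFromZero {x} (inj₂ (mk< δ δ>0 b)) = δ , δ>0 , weaken (λ {n} h →
    ℚP.≤-trans (ℚP.≤-reflexive (≡.sym (ℚP.+-identityˡ δ)))
      (ℚP.≤-trans h (p≤∣p∣ (seq x n)))) b

infix 9 _⁻¹[_]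

_⁻¹[_] : ∀ x → x # 0ℝ → ℝ
(x ⁻¹[ x#0 ]) .seq n = inv (seq x n)
(x ⁻¹[ x#0 ]) .cauchy ε>0 with awayFromZero {x} x#0
... | δ , δ>0 , L , b with recip δ>0
... | K , K>0 , δK≡1 with scale K>0 ε>0
... | η′ , η′>0 , ≡.refl with scale K>0 η′>0
... | η , η>0 , ≡.refl with cauchy x η>0
... | N , p = L ℕ.⊔ N , λ m n hm hn →
  inv-close {seq x m} {seq x n} {δ} {K} {η} δ>0 δK≡1
    (b m (ℕP.m⊔n≤o⇒m≤o L N hm)) (b n (ℕP.m⊔n≤o⇒m≤o L N hn))
    (p m n (ℕP.m⊔n≤o⇒n≤o L N hm) (ℕP.m⊔n≤o⇒n≤o L N hn))

*-inverseʳ : ∀ x (x#0 : x # 0ℝ) → x * x ⁻¹[ x#0 ] ≃ 1ℝ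
*-inverseʳ x x#0 .close ε>0 with awayFromZero {x} x#0
... | δ , δ>0 , b = weaken (λ {n} h →
  ℚP.≤-trans (ℚP.≤-reflexive
      (≡.trans (≡.cong (λ z → ℚ.∣ z ℚ.- 1ℚ ∣) (*-inv (≤∣∣⇒≢0 {seq x n} δ>0 h)))
               (dist-self 1ℚ)))
    (ℚP.<⇒≤ ε>0)) b

0<1 : 0ℝ < 1ℝ
0<1 = mk< 1ℚ (ℚP.positive⁻¹ 1ℚ) (always λ _ → ℚP.≤-refl)

<-respʳ-≃ : ∀ {x y z} → x < y → y ≃ z → x < z
<-respʳ-≃ {x} {y} {z} (mk< δ δ>0 b) y≃z with halve δ>0
... | η , η>0 , ≡.refl = mk< η η>0 (both (λ {n} → lem (seq x n)) b (close y≃z η>0))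
  where
  open +-*-Solver
  assoc : ∀ p η → p ℚ.+ (η ℚ.+ η) ≡ (p ℚ.+ η) ℚ.+ η
  assoc p η = ≡.sym (ℚP.+-assoc p η η)
  lem : ∀ p {q r} → p ℚ.+ (η ℚ.+ η) ℚ.≤ q → ℚ.∣ q ℚ.- r ∣ ℚ.≤ η → p ℚ.+ η ℚ.≤ r
  lem p {q} {r} h c = begin
    p ℚ.+ η                                 ≡⟨ cancel (p ℚ.+ η) η ⟩
    (p ℚ.+ η) ℚ.+ η ℚ.+ (ℚ.- η)             ≡⟨ ≡.cong (ℚ._+ (ℚ.- η)) (assoc p η) ⟨
    p ℚ.+ (η ℚ.+ η) ℚ.+ (ℚ.- η)             ≤⟨ ℚP.+-monoˡ-≤ (ℚ.- η) (ℚP.≤-trans h (dist⇒≤ {q} {r} c)) ⟩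
    r ℚ.+ η ℚ.+ (ℚ.- η)                     ≡⟨ cancel r η ⟨
    r                                       ∎
    where
    open ℚP.≤-Reasoning
    cancel : ∀ a b → a ≡ a ℚ.+ b ℚ.+ (ℚ.- b)
    cancel = solve 2 (λ a b → a := a :+ b :+ (:- b)) ≡.refl

0<+ : ∀ {x y} → 0ℝ < x → 0ℝ < y → 0ℝ < x + y
0<+ (mk< δ δ>0 b) (mk< η η>0 c) = mk< (δ ℚ.+ η) (+-pos {δ} {η} δ>0 η>0)
  (both (λ p q → ℚP.≤-trans (ℚP.≤-reflexive (lem δ η)) (ℚP.+-mono-≤ p q)) b c)
  where
  open +-*-Solver
  lem : ∀ δ η → 0ℚ ℚ.+ (δ ℚ.+ η) ≡ (0ℚ ℚ.+ δ) ℚ.+ (0ℚ ℚ.+ η)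
  lem = solve 2 (λ δ η → con 0ℚ :+ (δ :+ η) := (con 0ℚ :+ δ) :+ (con 0ℚ :+ η)) ≡.refl

0<* : ∀ {x y} → 0ℝ < x → 0ℝ < y → 0ℝ < x * y
0<* {x} {y} (mk< δ δ>0 b) (mk< η η>0 c) = mk< (δ ℚ.* η) (*-pos {δ} {η} δ>0 η>0)
  (both (λ {n} → lem (seq x n) (seq y n)) b c)
  where
  open ℚP.≤-Reasoning
  lem : ∀ p q → 0ℚ ℚ.+ δ ℚ.≤ p → 0ℚ ℚ.+ η ℚ.≤ q → 0ℚ ℚ.+ δ ℚ.* η ℚ.≤ p ℚ.* q
  lem p q δ≤p η≤q = begin
    0ℚ ℚ.+ δ ℚ.* η   ≡⟨ ℚP.+-identityˡ (δ ℚ.* η) ⟩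
    δ ℚ.* η          ≤⟨ *-monoˡ δ (ℚP.<⇒≤ δ>0) η≤q′ ⟩
    δ ℚ.* q          ≤⟨ *-monoʳ q (ℚP.≤-trans (ℚP.<⇒≤ η>0) η≤q′) δ≤p′ ⟩
    p ℚ.* q          ∎
    where
    η≤q′ = ℚP.≤-trans (ℚP.≤-reflexive (≡.sym (ℚP.+-identityˡ η))) η≤q
    δ≤p′ = ℚP.≤-trans (ℚP.≤-reflexive (≡.sym (ℚP.+-identityˡ δ))) δ≤p

#⇒-#0 : ∀ {x y} → x # y → x - y # 0ℝ
#⇒-#0 {x} {y} (inj₁ (mk< δ δ>0 b)) =
  inj₁ (mk< δ δ>0 (weaken (λ {n} → lem (seq x n) (seq y n)) b))
  where
  open ℚP.≤-Reasoning
  open +-*-Solver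
  eq : ∀ p q δ → p ℚ.- q ℚ.+ δ ≡ p ℚ.+ δ ℚ.+ (ℚ.- q)
  eq = solve 3 (λ p q δ → p :- q :+ δ := p :+ δ :+ (:- q)) ≡.refl
  lem : ∀ p q → p ℚ.+ δ ℚ.≤ q → p ℚ.- q ℚ.+ δ ℚ.≤ 0ℚ
  lem p q h = begin
    p ℚ.- q ℚ.+ δ      ≡⟨ eq p q δ ⟩
    p ℚ.+ δ ℚ.+ (ℚ.- q) ≤⟨ ℚP.+-monoˡ-≤ (ℚ.- q) h ⟩
    q ℚ.- q            ≡⟨ ℚP.+-inverseʳ q ⟩
    0ℚ                 ∎
#⇒-#0 {x} {y} (inj₂ (mk< δ δ>0 b)) =
  inj₂ (mk< δ δ>0 (weaken (λ {n} → lem (seq x n) (seq y n)) b))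
  where
  open ℚP.≤-Reasoning
  open +-*-Solver
  eq : ∀ q δ → 0ℚ ℚ.+ δ ≡ q ℚ.+ δ ℚ.+ (ℚ.- q)
  eq = solve 2 (λ q δ → con 0ℚ :+ δ := q :+ δ :+ (:- q)) ≡.refl
  lem : ∀ p q → q ℚ.+ δ ℚ.≤ p → 0ℚ ℚ.+ δ ℚ.≤ p ℚ.- q
  lem p q h = begin
    0ℚ ℚ.+ δ            ≡⟨ eq q δ ⟩
    q ℚ.+ δ ℚ.+ (ℚ.- q) ≤⟨ ℚP.+-monoˡ-≤ (ℚ.- q) h ⟩
    p ℚ.- q             ∎

eval : ∀ {m} → Vector ℝ m → ℝ → ℝ
eval c x = sum λ i → c i * x ^ toℕ i

record Polynomial (d : ℕ) : Set where
  field
    coeff     : Vector ℝ (suc d)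
    leading#0 : coeff (fromℕ d) # 0ℝ
open Polynomial public

⟦_⟧ : ∀ {d} → Polynomial d → ℝ → ℝ
⟦ P ⟧ = eval (coeff P)

ι : ℕ → ℝ
ι k = k · 1ℝ

module Carlitz (q : ℝ) (q>0 : 0ℝ < q) (q#1 : q # 1ℝ) where

  1/[q-1] : ℝ
  1/[q-1] = (q - 1ℝ) ⁻¹[ #⇒-#0 {q} {1ℝ} q#1 ]

  [_] : ℕ → ℝ
  [ n ] = (q ^ n - 1ℝ) * 1/[q-1]

  private

    open CommutativeRing ℝ-commutativeRing hiding (_+_; _*_; _-_; -_)
    open import Algebra.Properties.Ring (CommutativeRing.ring ℝ-commutativeRing)
    open import Relation.Binary.Reasoning.Setoid setoid

    [suc] : ∀ n → q * [ n ] + 1ℝ ≃ [ suc n ]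
    [suc] n = begin
      q * ((q ^ n - 1ℝ) * i) + 1ℝ            ≈⟨ +-cong (sym (*-assoc q (q ^ n - 1ℝ) i)) (sym (*-inverseʳ (q - 1ℝ) (#⇒-#0 {q} {1ℝ} q#1))) ⟩
      q * (q ^ n - 1ℝ) * i + (q - 1ℝ) * i    ≈⟨ sym (distribʳ i (q * (q ^ n - 1ℝ)) (q - 1ℝ)) ⟩
      (q * (q ^ n - 1ℝ) + (q - 1ℝ)) * i      ≈⟨ *-congʳ telescope ⟩
      (q * q ^ n - 1ℝ) * i                   ∎
      where
      i = 1/[q-1]
      telescope : q * (q ^ n - 1ℝ) + (q - 1ℝ) ≃ q * q ^ n - 1ℝ
      telescope = begin
        q * (q ^ n - 1ℝ) + (q - 1ℝ)          ≈⟨ +-congʳ (x[y-z]≈xy-xz q (q ^ n) 1ℝ) ⟩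
        q * q ^ n - q * 1ℝ + (q - 1ℝ)        ≈⟨ +-congʳ (+-congˡ (-‿cong (*-identityʳ q))) ⟩
        q * q ^ n - q + (q - 1ℝ)             ≈⟨ sym (+-assoc (q * q ^ n - q) q (- 1ℝ)) ⟩
        q * q ^ n - q + q - 1ℝ               ≈⟨ +-congʳ (+-assoc (q * q ^ n) (- q) q) ⟩
        q * q ^ n + (- q + q) - 1ℝ           ≈⟨ +-congʳ (+-congˡ (-‿inverseˡ q)) ⟩
        q * q ^ n + 0ℝ - 1ℝ                  ≈⟨ +-congʳ (+-identityʳ (q * q ^ n)) ⟩
        q * q ^ n - 1ℝ                       ∎

    [0] : [ 0 ] ≃ 0ℝ
    [0] = trans (*-congʳ (-‿inverseʳ 1ℝ)) (zeroˡ 1/[q-1])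

  [suc]>0 : ∀ n → 0ℝ < [ suc n ]
  [suc]>0 zero    = <-respʳ-≃ 0<1 (trans (sym (trans (+-congʳ (trans (*-congˡ [0]) (zeroʳ q))) (+-identityˡ 1ℝ))) ([suc] 0))
  [suc]>0 (suc n) = <-respʳ-≃ (0<+ (0<* q>0 ([suc]>0 n)) 0<1) ([suc] (suc n))

  1/[suc_] : ℕ → ℝ
  1/[suc n ] = [ suc n ] ⁻¹[ inj₂ ([suc]>0 n) ]

  -- The quotient k / [k], with the convention that it is 1 at k = 0.
  k/[k] : ℕ → ℝ
  k/[k] zero    = 1ℝ
  k/[k] (suc k) = ι (suc k) * 1/[suc k ]

  -- The sequence P(k) / [k + r].  The only vanishing denominator is at
  -- k = r = 0.  There the quotient has a meaning only if P(0) = 0: then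
  -- P(X) = X Q(X) with Q having the coefficients of P shifted by one, and
  -- P(k) / [k] = Q(k) (k / [k]) takes the value Q(0) at k = 0 by convention.
  quotient : ∀ {d} → Polynomial d → (r : ℕ) → ℕ → ℝ
  quotient P r       (suc k) = ⟦ P ⟧ (ι (suc k)) * 1/[suc k ℕ.+ r ]
  quotient P zero    zero    = eval (tail (coeff P)) 0ℝ * k/[k] 0
  quotient P (suc r) zero    = ⟦ P ⟧ 0ℝ * 1/[suc r ]

  -- A q-polynomial c₀ + c₁ q^X + ⋯ + cₙ q^(nX) is given by its coefficients;
  -- it is evaluated at X by substituting q ^ X in the ordinary polynomial.
  QPolynomial : ℕ → Set
  QPolynomial n = Vector ℝ (suc n)

  infix 5 _at_

  _at_ : ∀ {n} → QPolynomial n → ℕ → ℝ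
  f at X = eval f (q ^ X)

  T : (ℕ → ℝ) → (n : ℕ) → QPolynomial n
  T a n k = 1/[q-1] ^ n * ((- 1ℝ) ^ (n ℕ.∸ toℕ k) * ((n C toℕ k) · a (toℕ k)))

{-# OPTIONS --safe #-}

-- Write E for the shift of sequences, Δ = E − 1, and u = −1/(q − 1), so that
-- 1 + u q = u.  With b(k) = (−1)ᵏ a(k), the binomial theorem gives
-- t n = uⁿ ((1 + E)ⁿ b)(0), hence
--   Σₖ C(n,k) qᵏ t k = ((1 + u q (1 + E))ⁿ b)(0) = uⁿ ((1 + q E)ⁿ b)(0),
-- which is t n formed from the sequence qᵏ a(k).  For a(k) = P(k) / [k + r]
-- we have (q^(k+r) − 1) a(k) = (q − 1) P(k), so the two sides of the formula
-- differ by a multiple of (Δⁿ P)(0), which is 0 for n > d.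
module Submission where

open import Algebra.Bundles using (CommutativeRing)
open import Data.Fin.Base using (Fin; zero; suc; toℕ)
import Data.Fin.Properties as FinP
open import Data.Nat.Base as ℕ using (ℕ; zero; suc; _>_; z<s; s<s; s<s⁻¹)
open import Data.Nat.Combinatorics using (_C_; k>n⇒nCk≡0; nCk+nC[k+1]≡[n+1]C[k+1])
import Data.Nat.Properties as ℕP
open import Data.Sum.Base using (inj₂)
open import Function.Base using (_∘_)
open import Relation.Binary.PropositionalEquality.Core as ≡ using (_≡_)

module BinomialTransform {c ℓ} (R : CommutativeRing c ℓ) where

  open CommutativeRing R hiding (zero)
  open import Algebra.Properties.CommutativeSemiring.Exp commutativeSemiring
  open import Algebra.Properties.Semiring.Mult semiring
  open import Algebra.Properties.CommutativeMonoid.Mult +-commutativeMonoid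
    using (×-distrib-+)
  open import Algebra.Properties.Semiring.Sum semiring
  open import Algebra.Properties.Ring ring using (-1*x≈-x)
  open import Algebra.Solver.Ring.NaturalCoefficients.Default commutativeSemiring
    using (solve; _:=_; _:+_; _:*_; con)
  open import Relation.Binary.Reasoning.Setoid setoid

  -- Binomial sums: linearity and expansion in binomial coefficients.

  -- ((1 + E)ⁿ f)(0), with E the shift.
  binomialSum : ℕ → (ℕ → Carrier) → Carrier
  binomialSum zero    f = f 0
  binomialSum (suc n) f = binomialSum n f + binomialSum n (f ∘ suc)

  binomialSum-cong : ∀ n {f g} → (∀ k → f k ≈ g k) → binomialSum n f ≈ binomialSum n g
  binomialSum-cong zero    f≈g = f≈g 0
  binomialSum-cong (suc n) f≈g =
    +-cong (binomialSum-cong n f≈g) (binomialSum-cong n (f≈g ∘ suc))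

  binomialSum-+ : ∀ n f g →
    binomialSum n (λ k → f k + g k) ≈ binomialSum n f + binomialSum n g
  binomialSum-+ zero    f g = refl
  binomialSum-+ (suc n) f g = trans
    (+-cong (binomialSum-+ n f g) (binomialSum-+ n (f ∘ suc) (g ∘ suc)))
    (solve 4 (λ a b c d → (a :+ b) :+ (c :+ d) := (a :+ c) :+ (b :+ d)) refl _ _ _ _)

  binomialSum-* : ∀ n x f → binomialSum n (λ k → x * f k) ≈ x * binomialSum n f
  binomialSum-* zero    x f = refl
  binomialSum-* (suc n) x f = trans
    (+-cong (binomialSum-* n x f) (binomialSum-* n x (f ∘ suc)))
    (sym (distribˡ x _ _))

  binomialSum-zero : ∀ n → binomialSum n (λ _ → 0#) ≈ 0#
  binomialSum-zero zero    = refl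
  binomialSum-zero (suc n) =
    trans (+-cong (binomialSum-zero n) (binomialSum-zero n)) (+-identityˡ 0#)

  binomialSum-sum : ∀ n {m} (f : Fin m → ℕ → Carrier) →
    binomialSum n (λ k → sum (λ i → f i k)) ≈ sum (λ i → binomialSum n (f i))
  binomialSum-sum n {zero}  f = binomialSum-zero n
  binomialSum-sum n {suc m} f =
    trans (binomialSum-+ n (f zero) _) (+-congˡ (binomialSum-sum n (f ∘ suc)))

  -- The number m of terms is arbitrary, so that Pascal's rule can be applied
  -- to both halves of the sum without splitting off a last term.
  sum-C≈binomialSum : ∀ n f m → n ℕ.< m →
    sum {m} (λ k → (n C toℕ k) × f (toℕ k)) ≈ binomialSum n f
  sum-C≈binomialSum zero f (suc m) _ = begin
    1 × f 0 + sum {m} (λ k → (0 C suc (toℕ k)) × f (suc (toℕ k)))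
      ≈⟨ +-cong (×-homo-1 (f 0)) (sum-cong-≋ {m} λ k →
           ×-congˡ {f (suc (toℕ k))} (k>n⇒nCk≡0 {0} {suc (toℕ k)} z<s)) ⟩
    f 0 + sum {m} (λ _ → 0#)
      ≈⟨ +-congˡ (sum-replicate-zero m) ⟩
    f 0 + 0#
      ≈⟨ +-identityʳ (f 0) ⟩
    f 0 ∎
  sum-C≈binomialSum (suc n) f (suc m) 1+n<1+m = begin
    1 × f 0 + sum {m} (λ k → (suc n C suc (toℕ k)) × f (suc (toℕ k)))
      ≈⟨ +-congˡ (trans (sum-cong-≋ {m} pascal) (∑-distrib-+ {m} _ _)) ⟩
    1 × f 0 + (sum {m} (λ k → (n C toℕ k) × f (suc (toℕ k))) + higher)
      -- As `n C 0` computes to 1, `1 × f 0 + higher` is already the sum of `suc m` terms for `n`.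
      ≈⟨ solve 3 (λ a b c → a :+ (b :+ c) := (a :+ c) :+ b) refl _ _ _ ⟩
    sum {suc m} (λ k → (n C toℕ k) × f (toℕ k)) +
    sum {m} (λ k → (n C toℕ k) × f (suc (toℕ k)))
      ≈⟨ +-cong (sum-C≈binomialSum n f (suc m) (ℕP.m<n⇒m<1+n (s<s⁻¹ 1+n<1+m)))
                (sum-C≈binomialSum n (f ∘ suc) m (s<s⁻¹ 1+n<1+m)) ⟩
    binomialSum (suc n) f ∎
    where
    higher = sum {m} (λ k → (n C suc (toℕ k)) × f (suc (toℕ k)))
    pascal : ∀ (k : Fin m) → (suc n C suc (toℕ k)) × f (suc (toℕ k)) ≈
      (n C toℕ k) × f (suc (toℕ k)) + (n C suc (toℕ k)) × f (suc (toℕ k))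
    pascal k = trans
      (×-congˡ (≡.sym (nCk+nC[k+1]≡[n+1]C[k+1] n (toℕ k))))
      (×-homo-+ _ (n C toℕ k) (n C suc (toℕ k)))

  -- Iterating the binomial transform.

  -- (1 + u q (1 + E))ⁿ = uⁿ (1 + q E)ⁿ when 1 + u q = u.
  binomialSum-iterate : ∀ {u q} → 1# + u * q ≈ u → ∀ n f →
    binomialSum n (λ k → (u * q) ^ k * binomialSum k f) ≈
    u ^ n * binomialSum n (λ k → q ^ k * f k)
  binomialSum-iterate         1+uq≈u zero    f =
    *-congˡ (sym (*-identityˡ (f 0)))
  binomialSum-iterate {u} {q} 1+uq≈u (suc n) f = begin
    transform f +
    binomialSum n (λ k → u * q * (u * q) ^ k * (binomialSum k f + binomialSum k (f ∘ suc)))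
      ≈⟨ +-congˡ (trans
           (binomialSum-cong n λ k →
             solve 4 (λ c d x y → c :* d :* (x :+ y) := c :* (d :* x :+ d :* y))
               refl (u * q) ((u * q) ^ k) _ _)
           (trans (binomialSum-* n (u * q) _) (*-congˡ (binomialSum-+ n _ _)))) ⟩
    transform f + u * q * (transform f + transform (f ∘ suc))
      ≈⟨ +-cong ih (*-congˡ (+-cong ih (binomialSum-iterate 1+uq≈u n (f ∘ suc)))) ⟩
    u ^ n * x + u * q * (u ^ n * x + u ^ n * y)
      -- The coefficient of `x` collects to `1 + u q`, which the hypothesis turns into the missing
      -- factor `u`.
      ≈⟨ solve 5 (λ u q v x y →
           v :* x :+ u :* q :* (v :* x :+ v :* y) :=
           (con 1 :+ u :* q) :* (v :* x) :+ u :* v :* (q :* y)) refl u q (u ^ n) x y ⟩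
    (1# + u * q) * (u ^ n * x) + u * u ^ n * (q * y)
      ≈⟨ +-congʳ (trans (*-congʳ 1+uq≈u) (sym (*-assoc u (u ^ n) x))) ⟩
    u * u ^ n * x + u * u ^ n * (q * y)
      ≈⟨ distribˡ (u * u ^ n) x (q * y) ⟨
    u * u ^ n * (x + q * y)
      -- `q * y` is the binomial sum of the shifted sequence `q ^ suc k * f (suc k)`, the second
      -- half of `binomialSum (suc n)`.
      ≈⟨ *-congˡ (+-congˡ (trans (sym (binomialSum-* n q _))
           (binomialSum-cong n λ k → sym (*-assoc q (q ^ k) _)))) ⟩
    u ^ suc n * binomialSum (suc n) (λ k → q ^ k * f k) ∎
    where
    transform : (ℕ → Carrier) → Carrier
    transform g = binomialSum n (λ k → (u * q) ^ k * binomialSum k g)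
    x  = binomialSum n (λ k → q ^ k * f k)
    y  = binomialSum n (λ k → q ^ k * f (suc k))
    ih = binomialSum-iterate 1+uq≈u n f

  -- Vanishing of high differences of polynomials.

  -- k C(n+1,k) = (n+1) C(n,k−1)
  binomialSum-absorb : ∀ n f →
    binomialSum (suc n) (λ k → k × f k) ≈ suc n × binomialSum n (f ∘ suc)
  binomialSum-absorb zero    f = +-identityˡ (1 × f 1)
  binomialSum-absorb (suc n) f = begin
    binomialSum (suc n) (λ k → k × f k) +
    binomialSum (suc n) (λ k → f (suc k) + k × f (suc k))
      ≈⟨ +-cong (binomialSum-absorb n f)
           (trans (binomialSum-+ (suc n) (f ∘ suc) _)
                  (+-congˡ (binomialSum-absorb n (f ∘ suc)))) ⟩
    suc n × x + (z + suc n × y)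
      ≈⟨ solve 3 (λ a b c → a :+ (b :+ c) := b :+ (a :+ c)) refl _ _ _ ⟩
    z + (suc n × x + suc n × y)
      -- `z` unfolds to `x + y`, so the result is `suc (suc n) × z`.
      ≈⟨ +-congˡ (×-distrib-+ x y (suc n)) ⟨
    z + suc n × (x + y) ∎
    where
    x = binomialSum n (f ∘ suc)
    y = binomialSum n (λ k → f (suc (suc k)))
    z = binomialSum (suc n) (f ∘ suc)

  -- Up to sign this is an `n`-th difference of a power of degree `m < n`. Induction on the degree
  -- splits off one factor `x + k`: the `x` part has lower degree, and the `k` part is absorbed,
  -- which lowers `n` and shifts the sequence. The shift moves the base point from `x` to `x + 1`,
  -- hence the free `x`.
  alternating-power : ∀ m x n → n > m →
    binomialSum n (λ k → (- 1#) ^ k * (x + k × 1#) ^ m) ≈ 0#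
  alternating-power zero x (suc n) _ = begin
    -- For degree 0 the shifted sequence is the negative of the original, so a single factor `1 + E`
    -- kills it.
    s + binomialSum n (λ k → - 1# * (- 1#) ^ k * 1#)
      ≈⟨ +-congˡ (trans (binomialSum-cong n λ k → *-assoc (- 1#) _ 1#)
                        (binomialSum-* n (- 1#) _)) ⟩
    s + - 1# * s   ≈⟨ +-congˡ (-1*x≈-x s) ⟩
    s - s          ≈⟨ -‿inverseʳ s ⟩
    0#             ∎
    where s = binomialSum n (λ k → (- 1#) ^ k * 1#)
  alternating-power (suc m) x (suc n) 1+n>1+m = begin
    binomialSum (suc n) (λ k → (- 1#) ^ k * ((x + k × 1#) * (x + k × 1#) ^ m))
      ≈⟨ trans (binomialSum-cong (suc n) expand) (binomialSum-+ (suc n) _ _) ⟩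
    binomialSum (suc n) (λ k → x * f k) + binomialSum (suc n) (λ k → k × f k)
      ≈⟨ +-cong (binomialSum-* (suc n) x f) (binomialSum-absorb n f) ⟩
    x * binomialSum (suc n) f + suc n × binomialSum n (f ∘ suc)
      ≈⟨ +-cong
           (*-congˡ (alternating-power m x (suc n) (ℕP.m<n⇒m<1+n (s<s⁻¹ 1+n>1+m))))
           (×-congʳ (suc n) shifted) ⟩
    x * 0# + suc n × 0#
      -- The multiple `suc n × 0#` is read as a constant sum of zeros.
      ≈⟨ +-cong (zeroʳ x) (trans (sym (sum-replicate (suc n))) (sum-replicate-zero (suc n))) ⟩
    0# + 0#
      ≈⟨ +-identityˡ 0# ⟩
    0# ∎
    where
    f : ℕ → Carrier
    f k = (- 1#) ^ k * (x + k × 1#) ^ m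

    expand : ∀ k → (- 1#) ^ k * ((x + k × 1#) * (x + k × 1#) ^ m) ≈ x * f k + k × f k
    expand k = begin
      (- 1#) ^ k * ((x + k × 1#) * (x + k × 1#) ^ m)
        ≈⟨ solve 4 (λ e x j p → e :* ((x :+ j) :* p) := x :* (e :* p) :+ j :* (e :* p))
             refl ((- 1#) ^ k) x (k × 1#) ((x + k × 1#) ^ m) ⟩
      x * f k + (k × 1#) * f k
        ≈⟨ +-congˡ (trans (×-assoc-* k 1# (f k)) (×-congʳ k (*-identityˡ (f k)))) ⟩
      x * f k + k × f k ∎

    shifted : binomialSum n (f ∘ suc) ≈ 0#
    shifted = begin
      binomialSum n (f ∘ suc)
        ≈⟨ binomialSum-cong n (λ k → trans (*-assoc (- 1#) _ _)
             (*-congˡ (*-congˡ (^-congˡ m (sym (+-assoc x 1# (k × 1#))))))) ⟩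
      binomialSum n (λ k → - 1# * ((- 1#) ^ k * (x + 1# + k × 1#) ^ m))
        ≈⟨ binomialSum-* n (- 1#) _ ⟩
      - 1# * binomialSum n (λ k → (- 1#) ^ k * (x + 1# + k × 1#) ^ m)
        ≈⟨ *-congˡ (alternating-power m (x + 1#) n (s<s⁻¹ 1+n>1+m)) ⟩
      - 1# * 0#
        ≈⟨ zeroʳ (- 1#) ⟩
      0# ∎

  -- By linearity it suffices to treat the monomials. Here `d` counts coefficients, so every
  -- exponent is below `d`, hence below `n`.
  alternating-polynomial : ∀ {d} (c : Fin d → Carrier) n → d ℕ.≤ n →
    binomialSum n (λ k → (- 1#) ^ k * sum (λ i → c i * (k × 1#) ^ toℕ i)) ≈ 0#
  alternating-polynomial {d} c n d≤n = begin
    binomialSum n (λ k → (- 1#) ^ k * sum (λ i → c i * (k × 1#) ^ toℕ i))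
      ≈⟨ binomialSum-cong n (λ k → trans (*-distribˡ-sum {d} ((- 1#) ^ k) _)
           (sum-cong-≋ {d} λ i → solve 3 (λ a b c → a :* (b :* c) := b :* (a :* c)) refl _ _ _)) ⟩
    binomialSum n (λ k → sum (λ i → c i * ((- 1#) ^ k * (k × 1#) ^ toℕ i)))
      ≈⟨ binomialSum-sum n {d} _ ⟩
    sum (λ i → binomialSum n (λ k → c i * ((- 1#) ^ k * (k × 1#) ^ toℕ i)))
      ≈⟨ sum-cong-≋ {d} vanish ⟩
    sum {d} (λ _ → 0#)
      ≈⟨ sum-replicate-zero d ⟩
    0# ∎
    where
    vanish : ∀ i → binomialSum n (λ k → c i * ((- 1#) ^ k * (k × 1#) ^ toℕ i)) ≈ 0#
    vanish i = begin
      binomialSum n (λ k → c i * ((- 1#) ^ k * (k × 1#) ^ toℕ i))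
        ≈⟨ binomialSum-* n (c i) _ ⟩
      c i * binomialSum n (λ k → (- 1#) ^ k * (k × 1#) ^ toℕ i)
        ≈⟨ *-congˡ (binomialSum-cong n λ k →
             *-congˡ (^-congˡ (toℕ i) (sym (+-identityˡ (k × 1#))))) ⟩
      c i * binomialSum n (λ k → (- 1#) ^ k * (0# + k × 1#) ^ toℕ i)
        ≈⟨ *-congˡ (alternating-power (toℕ i) 0# n (ℕP.<-≤-trans (FinP.toℕ<n i) d≤n)) ⟩
      c i * 0#
        ≈⟨ zeroʳ (c i) ⟩
      0# ∎

  -- Signs and the closed form of the sequence at 0.

  1^n≈1 : ∀ n → 1# ^ n ≈ 1#
  1^n≈1 zero    = refl
  1^n≈1 (suc n) = trans (*-identityˡ (1# ^ n)) (1^n≈1 n)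

  -1*-1≈1 : - 1# * - 1# ≈ 1#
  -1*-1≈1 = begin
    - 1# * - 1#                  ≈⟨ +-identityˡ _ ⟨
    0# + - 1# * - 1#             ≈⟨ +-congʳ (-‿inverseʳ 1#) ⟨
    -- Here and below `- 1#` is an atom `e` of a semiring identity, and `1 + e ≈ 0` is applied
    -- separately.
    1# + - 1# + - 1# * - 1#      ≈⟨ solve 1 (λ e → con 1 :+ e :+ e :* e := con 1 :+ e :* (con 1 :+ e)) refl (- 1#) ⟩
    1# + - 1# * (1# + - 1#)      ≈⟨ +-congˡ (trans (*-congˡ (-‿inverseʳ 1#)) (zeroʳ (- 1#))) ⟩
    1# + 0#                      ≈⟨ +-identityʳ 1# ⟩
    1#                           ∎

  -- The square of `(- 1#) ^ k` is 1. This separates `n` from `k`, so that the sign depending on `n`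
  -- can leave the sum.
  sign-∸ : ∀ {k n} → k ℕ.≤ n → (- 1#) ^ (n ℕ.∸ k) ≈ (- 1#) ^ n * (- 1#) ^ k
  sign-∸ {k} {n} k≤n = sym (begin
    (- 1#) ^ n * (- 1#) ^ k
      ≈⟨ *-congʳ (trans (^-congʳ (- 1#) (≡.sym (ℕP.m∸n+n≡m k≤n))) (^-homo-* (- 1#) (n ℕ.∸ k) k)) ⟩
    (- 1#) ^ (n ℕ.∸ k) * (- 1#) ^ k * (- 1#) ^ k
      ≈⟨ *-assoc _ _ _ ⟩
    (- 1#) ^ (n ℕ.∸ k) * ((- 1#) ^ k * (- 1#) ^ k)
      ≈⟨ *-congˡ (trans (sym (^-distrib-* (- 1#) (- 1#) k))
           (trans (^-congˡ k -1*-1≈1) (1^n≈1 k))) ⟩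
    (- 1#) ^ (n ℕ.∸ k) * 1#
      ≈⟨ *-identityʳ _ ⟩
    (- 1#) ^ (n ℕ.∸ k) ∎)

  -- The sign `(- 1#) ^ n` merges with `i ^ n` into the power of `u = i * - 1#`. The element `y`
  -- stands for `q ^ 0`, the point where a `q`-polynomial is evaluated for `X = 0`.
  sum-signed-C≈binomialSum : ∀ i n (a : ℕ → Carrier) {y} → y ≈ 1# →
    sum {suc n} (λ k →
      i ^ n * ((- 1#) ^ (n ℕ.∸ toℕ k) * ((n C toℕ k) × a (toℕ k))) * y ^ toℕ k) ≈
    (i * - 1#) ^ n * binomialSum n (λ k → (- 1#) ^ k * a k)
  sum-signed-C≈binomialSum i n a {y} y≈1 = begin
    sum {suc n} (λ k →
      i ^ n * ((- 1#) ^ (n ℕ.∸ toℕ k) * ((n C toℕ k) × a (toℕ k))) * y ^ toℕ k)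
      ≈⟨ sum-cong-≋ {suc n} term ⟩
    sum {suc n} (λ k → (i * - 1#) ^ n * ((n C toℕ k) × ((- 1#) ^ toℕ k * a (toℕ k))))
      ≈⟨ *-distribˡ-sum {suc n} ((i * - 1#) ^ n)
           (λ k → (n C toℕ k) × ((- 1#) ^ toℕ k * a (toℕ k))) ⟨
    (i * - 1#) ^ n * sum {suc n} (λ k → (n C toℕ k) × ((- 1#) ^ toℕ k * a (toℕ k)))
      ≈⟨ *-congˡ (sum-C≈binomialSum n _ (suc n) (ℕP.n<1+n n)) ⟩
    (i * - 1#) ^ n * binomialSum n (λ k → (- 1#) ^ k * a k) ∎
    where
    term : ∀ (k : Fin (suc n)) →
      i ^ n * ((- 1#) ^ (n ℕ.∸ toℕ k) * ((n C toℕ k) × a (toℕ k))) * y ^ toℕ k ≈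
      (i * - 1#) ^ n * ((n C toℕ k) × ((- 1#) ^ toℕ k * a (toℕ k)))
    term k = begin
      i ^ n * ((- 1#) ^ (n ℕ.∸ toℕ k) * x) * y ^ toℕ k
        ≈⟨ *-cong (*-congˡ (*-congʳ (sign-∸ (FinP.toℕ≤pred[n] k))))
                  (trans (^-congˡ (toℕ k) y≈1) (1^n≈1 (toℕ k))) ⟩
      i ^ n * ((- 1#) ^ n * (- 1#) ^ toℕ k * x) * 1#
        ≈⟨ solve 4 (λ i e s x → i :* (e :* s :* x) :* con 1 := i :* e :* (s :* x))
             refl (i ^ n) ((- 1#) ^ n) ((- 1#) ^ toℕ k) x ⟩
      i ^ n * (- 1#) ^ n * ((- 1#) ^ toℕ k * x)
        ≈⟨ *-cong (sym (^-distrib-* i (- 1#) n)) (×-comm-* (n C toℕ k) _ _) ⟩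
      (i * - 1#) ^ n * ((n C toℕ k) × ((- 1#) ^ toℕ k * a (toℕ k))) ∎
      where x = (n C toℕ k) × a (toℕ k)

  -- The recurrence over a commutative ring.

  1+[i*-1]*q≈i*-1 : ∀ {q i} → (q - 1#) * i ≈ 1# → 1# + i * - 1# * q ≈ i * - 1#
  1+[i*-1]*q≈i*-1 {q} {i} inverse = begin
    1# + i * - 1# * q
      -- Writing 1 as `(q - 1#) * i` makes the multiples of `q * i` cancel.
      ≈⟨ +-congʳ inverse ⟨
    (q + - 1#) * i + i * - 1# * q
      ≈⟨ solve 3 (λ q e i → (q :+ e) :* i :+ i :* e :* q := i :* e :+ (con 1 :+ e) :* (q :* i))
           refl q (- 1#) i ⟩
    i * - 1# + (1# + - 1#) * (q * i)
      ≈⟨ +-congˡ (trans (*-congʳ (-‿inverseʳ 1#)) (zeroˡ (q * i))) ⟩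
    i * - 1# + 0#
      ≈⟨ +-identityʳ _ ⟩
    i * - 1# ∎

  -- For `w = q - 1` and `x = q ^ (k + r)`, the factor `(x - 1#) * i` is the `q`-number of `k + r`.
  -- Multiplying by `w` cancels `i`, so `x` acts on `a` as the identity up to a multiple of `p`.
  clear-denominator : ∀ {w i x a p} → w * i ≈ 1# → (x - 1#) * i * a ≈ p → x * a ≈ a + w * p
  clear-denominator {w} {i} {x} {a} {p} inverse eq = sym (begin
    a + w * p
      ≈⟨ +-congˡ (*-congˡ eq) ⟨
    a + w * ((x + - 1#) * i * a)
      ≈⟨ +-congˡ (solve 5 (λ w x e i a → w :* ((x :+ e) :* i :* a) := w :* i :* ((x :+ e) :* a))
           refl w x (- 1#) i a) ⟩
    a + w * i * ((x + - 1#) * a)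
      ≈⟨ +-congˡ (trans (*-congʳ inverse) (*-identityˡ _)) ⟩
    a + (x + - 1#) * a
      ≈⟨ solve 3 (λ a x e → a :+ (x :+ e) :* a := x :* a :+ (con 1 :+ e) :* a) refl a x (- 1#) ⟩
    x * a + (1# + - 1#) * a
      ≈⟨ +-congˡ (trans (*-congʳ (-‿inverseʳ 1#)) (zeroˡ a)) ⟩
    x * a + 0#
      ≈⟨ +-identityʳ _ ⟩
    x * a ∎)

  -- The two sides differ by `u ^ n * (q - 1#)` times the alternating sum of `p`, assumed to vanish.
  -- The denominators enter only in cleared form, so a zero denominator is admissible.
  alternating-recurrence : ∀ {q i r} {a p : ℕ → Carrier} →
    (q - 1#) * i ≈ 1# →
    (∀ k → (q ^ (k ℕ.+ r) - 1#) * i * a k ≈ p k) →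
    ∀ n → binomialSum n (λ k → (- 1#) ^ k * p k) ≈ 0# →
    let t = λ m → (i * - 1#) ^ m * binomialSum m (λ k → (- 1#) ^ k * a k) in
    q ^ r * sum {suc n} (λ k → (n C toℕ k) × (q ^ toℕ k * t (toℕ k))) ≈ t n
  alternating-recurrence {q} {i} {r} {a} {p} inverse eq n vanish = begin
    q ^ r * sum {suc n} (λ k → (n C toℕ k) × (q ^ toℕ k * t (toℕ k)))
      ≈⟨ *-congˡ (sum-C≈binomialSum n (λ k → q ^ k * t k) (suc n) (ℕP.n<1+n n)) ⟩
    q ^ r * binomialSum n (λ k → q ^ k * t k)
      ≈⟨ *-congˡ (binomialSum-cong n λ k → trans
           (solve 3 (λ q u s → q :* (u :* s) := u :* q :* s) refl (q ^ k) (u ^ k) _)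
           (*-congʳ (sym (^-distrib-* u q k)))) ⟩
    q ^ r * binomialSum n (λ k → (u * q) ^ k * binomialSum k b)
      ≈⟨ *-congˡ (binomialSum-iterate (1+[i*-1]*q≈i*-1 inverse) n b) ⟩
    q ^ r * (u ^ n * binomialSum n (λ k → q ^ k * b k))
      ≈⟨ trans (solve 3 (λ q u s → q :* (u :* s) := u :* (q :* s)) refl (q ^ r) (u ^ n) _)
           (*-congˡ (sym (binomialSum-* n (q ^ r) _))) ⟩
    u ^ n * binomialSum n (λ k → q ^ r * (q ^ k * b k))
      ≈⟨ *-congˡ (trans (binomialSum-cong n term) (binomialSum-+ n b _)) ⟩
    u ^ n * (binomialSum n b + binomialSum n (λ k → (q - 1#) * ((- 1#) ^ k * p k)))
      ≈⟨ *-congˡ (+-congˡ (trans (binomialSum-* n (q - 1#) _)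
           (trans (*-congˡ vanish) (zeroʳ (q - 1#))))) ⟩
    u ^ n * (binomialSum n b + 0#)
      ≈⟨ *-congˡ (+-identityʳ _) ⟩
    t n ∎
    where
    u = i * - 1#
    b : ℕ → Carrier
    b k = (- 1#) ^ k * a k
    t : ℕ → Carrier
    t m = u ^ m * binomialSum m b
    term : ∀ k → q ^ r * (q ^ k * b k) ≈ b k + (q - 1#) * ((- 1#) ^ k * p k)
    term k = begin
      q ^ r * (q ^ k * ((- 1#) ^ k * a k))
        ≈⟨ solve 4 (λ x y s a → x :* (y :* (s :* a)) := s :* (y :* x :* a))
             refl (q ^ r) (q ^ k) ((- 1#) ^ k) (a k) ⟩
      (- 1#) ^ k * (q ^ k * q ^ r * a k)
        ≈⟨ *-congˡ (trans (*-congʳ (sym (^-homo-* q k r))) (clear-denominator inverse (eq k))) ⟩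
      (- 1#) ^ k * (a k + (q - 1#) * p k)
        ≈⟨ solve 4 (λ s a w p → s :* (a :+ w :* p) := s :* a :+ w :* (s :* p))
             refl ((- 1#) ^ k) (a k) (q - 1#) (p k) ⟩
      b k + (q - 1#) * ((- 1#) ^ k * p k) ∎

-- Specialisation to the real quotient sequence.

open import Defs
open BinomialTransform ℝ-commutativeRing

private
  module Ring = CommutativeRing ℝ-commutativeRing
  module Sum where
    open import Algebra.Properties.Semiring.Sum Ring.semiring public
  module Mult where
    open import Algebra.Properties.Semiring.Mult Ring.semiring public

*-cancel-inverse : ∀ x p (x#0 : x # 0ℝ) → x * (p * x ⁻¹[ x#0 ]) ≃ p
*-cancel-inverse x p x#0 =
  ≃-trans (*ℝ-cong {x} {x} ≃-refl (Ring.*-comm p (x ⁻¹[ x#0 ])))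
  (≃-trans (≃-sym (Ring.*-assoc x (x ⁻¹[ x#0 ]) p))
  (≃-trans (*ℝ-cong (*-inverseʳ x x#0) (≃-refl {p})) (Ring.*-identityˡ p)))

module _ (q : ℝ) (q>0 : 0ℝ < q) (q#1 : q # 1ℝ) where

  open Carlitz q q>0 q#1

  -- Unless `k = r = 0`, the denominator is positive and cancels. At `k = r = 0` both sides are 0:
  -- the left since `[ 0 ]` is 0, the right by the assumption on `P` at 0.
  [k+r]*quotient : ∀ {d} (P : Polynomial d) r → (r ≡ 0 → ⟦ P ⟧ 0ℝ ≃ 0ℝ) →
    ∀ k → [ k ℕ.+ r ] * quotient P r k ≃ ⟦ P ⟧ (ι k)
  [k+r]*quotient P r       _    (suc k) =
    *-cancel-inverse [ suc k ℕ.+ r ] (⟦ P ⟧ (ι (suc k))) (inj₂ ([suc]>0 (k ℕ.+ r)))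
  [k+r]*quotient P (suc r) _    zero    =
    *-cancel-inverse [ suc r ] (⟦ P ⟧ 0ℝ) (inj₂ ([suc]>0 r))
  [k+r]*quotient P zero    P0≃0 zero    =
    ≃-trans (*ℝ-cong [0]≃0 (≃-refl {quotient P 0 0}))
    (≃-trans (Ring.zeroˡ (quotient P 0 0)) (≃-sym (P0≃0 ≡.refl)))
    where
    [0]≃0 : [ 0 ] ≃ 0ℝ
    [0]≃0 = ≃-trans (*ℝ-cong (Ring.-‿inverseʳ 1ℝ) (≃-refl {1/[q-1]})) (Ring.zeroˡ 1/[q-1])

theorem2p9 : (q : ℝ) (q>0 : 0ℝ < q) (q#1 : q # 1ℝ) →
    let open Carlitz q q>0 q#1 in
    (r d : ℕ) (P : Polynomial d) → (r ≡ 0 → ⟦ P ⟧ 0ℝ ≃ 0ℝ) →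
    let t : ℕ → ℝ
        t n = T (quotient P r) n at 0
    in
    ∀ n → n > d →
    q ^ r * ∑[ k ≤ n ] ((n C toℕ k) · (q ^ toℕ k * t (toℕ k))) ≃ t n
theorem2p9 q q>0 q#1 r d P P0≃0 n n>d =
  ≃-trans
    (*ℝ-cong {q ^ r} ≃-refl (Sum.sum-cong-≋ {suc n} λ k →
      Mult.×-congʳ (n C toℕ k) (*ℝ-cong {q ^ toℕ k} ≃-refl (t-closed (toℕ k)))))
  (≃-trans
    (alternating-recurrence {q} {1/[q-1]} {r} {quotient P r} {λ k → ⟦ P ⟧ (ι k)}
      (*-inverseʳ (q - 1ℝ) (#⇒-#0 {q} {1ℝ} q#1))
      ([k+r]*quotient q q>0 q#1 P r P0≃0)
      -- `n > d` unfolds to `suc d ≤ n`, and `suc d` is the number of coefficients of `P`.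
      n (alternating-polynomial (coeff P) n n>d))
    (≃-sym (t-closed n)))
  where
  open Carlitz q q>0 q#1
  t-closed : ∀ m → T (quotient P r) m at 0 ≃
    (1/[q-1] * - 1ℝ) ^ m * binomialSum m (λ k → (- 1ℝ) ^ k * quotient P r k)
  t-closed m = sum-signed-C≈binomialSum 1/[q-1] m (quotient P r) ≃-refl
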